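{- Let $G$ be a connected graph on $n\ge 12$ vertices with $\gamma(G)\neq 2$. Then the parameters $dv(G,k_1,k_2,k_3)$ for all nonnegative integers $k_1,k_2,k_3$ with $0\le k_1+k_2+k_3\le n-3$, and $dv(G,k_1,k,k)$ for all nonnegative integers $k_1,k$ with $0\le k_1+2k\le n-3$, are reconstructible; that is, for every graph $H$ with $\mathscr{D}(H)=\mathscr{D}(G)$ these parameters take the same values on $H$ as on $G$.
   Context: All graphs are finite, simple and undirected; $\gamma(G)$ is the domination number. For a vertex $v$, the card $G-v$ is the unlabeled graph obtained by deleting $v$; the deck $\mathscr{D}(G)$ is the multiset of all cards. For nonnegative integers $k_1,k_2,k_3$, $dv(G,k_1,k_2,k_3)$ denotes the number of pairs of non-adjacent vertices $x$ and $y$ in $G$ such that exactly $k_1$ vertices are adjacent to both $x$ and $y$, exactly $k_2$ vertices are adjacent to $x$ but not to $y$, and exactly $k_3$ vertices are adjacent to $y$ but not to $x$. -}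

module Defs where

open import Data.Bool using (Bool; true; false)
open import Data.Bool.Properties using () renaming (_≟_ to _≟ᵇ_)
open import Data.Fin using (Fin; punchIn) renaming (_<_ to _<ᶠ_)
open import Data.Fin.Properties using (all?; any?) renaming (_<?_ to _<ᶠ?_)
open import Data.Fin.Subset using (Subset; ⊤; _∈_; _∩_; _─_; ∣_∣)
open import Data.Fin.Subset.Properties using (_∈?_; ∈⊤; anySubset?)
open import Data.List using (List; map; filter; length; allFin; cartesianProduct)
import Data.List.Relation.Binary.Permutation.Setoid as Permutation
open import Data.Nat using (ℕ; suc; pred; _≤_; _<_)
open import Data.Nat.Induction using (<-wellFounded)
open import Data.Nat.Properties using (_≟_; _<?_; ≮⇒≥)
open import Data.Product using (Σ; ∃; _×_; _,_; proj₁)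
open import Data.Sum using (_⊎_; inj₁)
open import Data.Vec using (tabulate)
open import Function.Bundles using (_↔_; Inverse)
open import Function.Construct.Composition using (_↔-∘_)
open import Function.Construct.Identity using (↔-id)
open import Function.Construct.Symmetry using (↔-sym)
open import Induction.WellFounded using (Acc; acc)
open import Level using (0ℓ)
open import Relation.Binary using (Setoid)
open import Relation.Binary.Construct.Closure.ReflexiveTransitive using (Star)
open import Relation.Binary.PropositionalEquality using (_≡_; refl; sym; trans; cong₂)
open import Relation.Nullary using (¬_; Dec; yes; no)
open import Relation.Nullary.Decidable using (_×-dec_; _⊎-dec_; ¬?)
open import Relation.Unary using (Decidable)

record Graph (n : ℕ) : Set where
  field
    adj        : Fin n → Fin n → Bool
    adj-sym    : ∀ x y → adj x y ≡ adj y x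
    adj-irrefl : ∀ x → adj x x ≡ false

open Graph public

Adj : ∀ {n} → Graph n → Fin n → Fin n → Set
Adj G x y = adj G x y ≡ true

adj? : ∀ {n} (G : Graph n) (x y : Fin n) → Dec (Adj G x y)
adj? G x y = adj G x y ≟ᵇ true

N : ∀ {n} → Graph n → Fin n → Subset n
N G x = tabulate (adj G x)

Connected : ∀ {n} → Graph n → Set
Connected G = ∀ x y → Star (Adj G) x y

Dominating : ∀ {n} → Graph n → Subset n → Set
Dominating G S = ∀ v → v ∈ S ⊎ ∃ λ u → u ∈ S × Adj G u v

dominating? : ∀ {n} (G : Graph n) → Decidable (Dominating G)
dominating? G S =
  all? λ v → (v ∈? S) ⊎-dec any? λ u → (u ∈? S) ×-dec adj? G u v

MinimumDominating : ∀ {n} → Graph n → Subset n → Set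
MinimumDominating G S =
  Dominating G S × (∀ T → Dominating G T → ∣ S ∣ ≤ ∣ T ∣)

minimumDominatingSet : ∀ {n} (G : Graph n) → ∃ (MinimumDominating G)
minimumDominatingSet G = descend ⊤ (λ _ → inj₁ ∈⊤) (<-wellFounded _)
  where
  descend : ∀ S → Dominating G S → Acc _<_ ∣ S ∣ → ∃ (MinimumDominating G)
  descend S S-dom (acc smaller)
    with anySubset? (λ T → dominating? G T ×-dec (∣ T ∣ <? ∣ S ∣))
  ... | yes (T , T-dom , T<S) = descend T T-dom (smaller T<S)
  ... | no none = S , S-dom , λ T T-dom → ≮⇒≥ λ T<S → none (T , T-dom , T<S)

γ : ∀ {n} → Graph n → ℕ
γ G = ∣ proj₁ (minimumDominatingSet G) ∣

infix 4 _≅_ _≅ᵘ_ _≈ᴰ_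

_≅_ : ∀ {m n} → Graph m → Graph n → Set
_≅_ {m} {n} G H =
  Σ (Fin m ↔ Fin n) λ f →
    ∀ x y → adj G x y ≡ adj H (Inverse.to f x) (Inverse.to f y)

≅-refl : ∀ {n} {G : Graph n} → G ≅ G
≅-refl = ↔-id _ , λ _ _ → refl

≅-sym : ∀ {m n} {G : Graph m} {H : Graph n} → G ≅ H → H ≅ G
≅-sym {H = H} (f , f-adj) = ↔-sym f , λ x y →
  trans (sym (cong₂ (adj H) (strictlyInverseˡ x) (strictlyInverseˡ y)))
        (sym (f-adj (from x) (from y)))
  where open Inverse f

≅-trans : ∀ {l m n} {G : Graph l} {H : Graph m} {K : Graph n} →
          G ≅ H → H ≅ K → G ≅ K
≅-trans (f , f-adj) (g , g-adj) = g ↔-∘ f , λ x y →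
  trans (f-adj x y) (g-adj (Inverse.to f x) (Inverse.to f y))

_≅ᵘ_ : ∃ Graph → ∃ Graph → Set
(_ , G) ≅ᵘ (_ , H) = G ≅ H

-- Unlabelled graphs: graphs of any order, with isomorphism as equality.
unlabelledGraphs : Setoid 0ℓ 0ℓ
unlabelledGraphs = record
  { Carrier       = ∃ Graph
  ; _≈_           = _≅ᵘ_
  ; isEquivalence = record
    { refl  = λ {(_ , G)} → ≅-refl {G = G}
    ; sym   = λ {(_ , G)} {(_ , H)} → ≅-sym {G = G} {H}
    ; trans = λ {(_ , G)} {(_ , H)} {(_ , K)} → ≅-trans {G = G} {H} {K}
    }
  }

card : ∀ {n} → Graph n → Fin n → Graph (pred n)
card {suc _} G v = record
  { adj        = λ x y → adj G (punchIn v x) (punchIn v y)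
  ; adj-sym    = λ x y → adj-sym G (punchIn v x) (punchIn v y)
  ; adj-irrefl = λ x → adj-irrefl G (punchIn v x)
  }

deck : ∀ {n} → Graph n → List (∃ Graph)
deck {n} G = map (λ v → pred n , card G v) (allFin n)

-- Equality of multisets of unlabelled graphs: permutation up to isomorphism.
_≈ᴰ_ : List (∃ Graph) → List (∃ Graph) → Set
_≈ᴰ_ = Permutation._↭_ unlabelledGraphs

record Profile {n} (G : Graph n) (k₁ k₂ k₃ : ℕ) (x y : Fin n) : Set where
  constructor profile
  field
    common : ∣ N G x ∩ N G y ∣ ≡ k₁
    only-x : ∣ N G x ─ N G y ∣ ≡ k₂
    only-y : ∣ N G y ─ N G x ∣ ≡ k₃

profile? : ∀ {n} (G : Graph n) k₁ k₂ k₃ x y → Dec (Profile G k₁ k₂ k₃ x y)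
profile? G k₁ k₂ k₃ x y
  with ∣ N G x ∩ N G y ∣ ≟ k₁ | ∣ N G x ─ N G y ∣ ≟ k₂ | ∣ N G y ─ N G x ∣ ≟ k₃
... | yes p | yes q | yes r = yes (profile p q r)
... | no ¬p | _     | _     = no λ π → ¬p (Profile.common π)
... | yes _ | no ¬q | _     = no λ π → ¬q (Profile.only-x π)
... | yes _ | yes _ | no ¬r = no λ π → ¬r (Profile.only-y π)

-- An unordered pair {x , y} is represented by x < y; since the roles of the
-- two vertices are not fixed by this, either labelling may realise (k₁, k₂, k₃).
DvPair : ∀ {n} → Graph n → (k₁ k₂ k₃ : ℕ) → Fin n × Fin n → Set
DvPair G k₁ k₂ k₃ (x , y) =
  x <ᶠ y × ¬ Adj G x y × (Profile G k₁ k₂ k₃ x y ⊎ Profile G k₁ k₂ k₃ y x)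

dvPair? : ∀ {n} (G : Graph n) k₁ k₂ k₃ → Decidable (DvPair G k₁ k₂ k₃)
dvPair? G k₁ k₂ k₃ (x , y) =
  (x <ᶠ? y) ×-dec ¬? (adj? G x y) ×-dec
  (profile? G k₁ k₂ k₃ x y ⊎-dec profile? G k₁ k₂ k₃ y x)

dv : ∀ {n} → Graph n → (k₁ k₂ k₃ : ℕ) → ℕ
dv {n} G k₁ k₂ k₃ =
  length (filter (dvPair? G k₁ k₂ k₃) (cartesianProduct (allFin n) (allFin n)))

{-# OPTIONS --safe #-}
module Submission where

-- Classify the n - 2 other vertices z of a non-adjacent pair (x , y) by whether z is
-- adjacent to both, only x, only y, or neither, and let pairSum G w add up a weight w of
-- the four class sizes over all such pairs.  Summing over the cards gives
-- ∑ᵥ pairSum (G - v) w = pairSum G (∂ w), so every weight of the form ∂ w is reconstructible.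
-- For the indicator of sizes (a, b, c, r) this determines the count at r + 1 from counts
-- at r, so everything reduces to r = 0, i.e. to non-adjacent dominating pairs.
-- If G has a universal vertex, so has H, and deleting both leaves isomorphic cards.
-- Otherwise γ G ≢ 2 says that G has no dominating pair; the recursion for the numbers of
-- pairs missing exactly i vertices has binomial coefficients as solution, so dominating
-- pairs in H would force more than n² pairs missing exactly 4 vertices.

open import Defs
open import Data.Bool using (Bool; true; false; not; _∧_; _∨_)
open import Data.Bool.Properties using (¬-not) renaming (_≟_ to _≟ᵇ_)
open import Data.Fin using (Fin; zero; suc; punchIn)
open import Data.Fin.Properties as Fin using (punchIn-injective; punchInᵢ≢i; all?; any?; ¬∀⟶∃¬)
  renaming (_<?_ to _<ᶠ?_)
open import Data.Fin.Subset using (Subset; _∈_; _∩_; _─_; _∪_; ∣_∣; ⁅_⁆)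
open import Data.Fin.Subset.Properties using (x∈⁅x⁆; x∈⁅y⁆⇒x≡y; x∈p∪q⁺; p⊂q⇒∣p∣<∣q∣; ∣⁅x⁆∣≡1; ∩-comm)
open import Data.List as List using (_++_; foldr; filter; length; allFin; cartesianProduct)
open import Data.List.Properties using (map-tabulate; length-tabulate; length-map; length-++; filter-++)
open import Data.List.Relation.Binary.Permutation.Setoid using (↭-sym)
import Data.List.Relation.Binary.Permutation.Setoid.Properties as ↭
import Data.List.Relation.Unary.Any.Properties as Any
open import Data.Nat using (ℕ; zero; suc; _+_; _*_; _∸_; _≤_; _<_; z≤n; s≤s)
open import Data.Nat.Properties
open import Data.Nat.Tactic.RingSolver using (solve-∀)
open import Data.Sum using (_⊎_; inj₁; inj₂; [_,_]′)
open import Data.Vec using ([]; _∷_; lookup)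
open import Data.Vec.Properties using (lookup∘tabulate)
open import Data.Product using (_×_; _,_; ∃; proj₁; proj₂)
open import Function using (_∘_)
open import Function.Bundles using (_↔_; Injection; Inverse)
open import Function.Properties.Inverse using (↔⇒↣)
open import Relation.Binary using (tri<; tri≈; tri>)
open import Relation.Binary.PropositionalEquality using (_≡_; _≢_; refl; sym; trans; cong; cong₂; subst; setoid)
open import Relation.Binary.PropositionalEquality using (module ≡-Reasoning)
open import Relation.Unary using (Pred; Decidable)
open import Relation.Nullary using (¬_; yes; no; does; contradiction)
open import Relation.Nullary.Decidable using (dec-true; dec-false)

import Algebra.Properties.Semiring.Sum +-*-semiring as S

-- Finite sums and counting

⟦_⟧ : Bool → ℕ
⟦ true  ⟧ = 1
⟦ false ⟧ = 0

-- Opaque so that the unifier can read off the summand.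
opaque
  sum : ∀ {n} → (Fin n → ℕ) → ℕ
  sum = S.sum

∑-syntax : ∀ n → (Fin n → ℕ) → ℕ
∑-syntax n = sum

infixl 10 ∑-syntax
syntax ∑-syntax n (λ i → e) = ∑[ i < n ] e

opaque
  unfolding sum

  sum-zero : ∀ {n} {f : Fin n → ℕ} → (∀ i → f i ≡ 0) → sum f ≡ 0
  sum-zero {zero}  eq = refl
  sum-zero {suc n} eq = cong₂ _+_ (eq zero) (sum-zero (eq ∘ suc))

  sum-mono-≤ : ∀ {n} {f g : Fin n → ℕ} → (∀ i → f i ≤ g i) → sum f ≤ sum g
  sum-mono-≤ {zero}  le = z≤n
  sum-mono-≤ {suc n} le = +-mono-≤ (le zero) (sum-mono-≤ (le ∘ suc))

  sum-const : ∀ n k → ∑[ i < n ] k ≡ n * k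
  sum-const zero    k = refl
  sum-const (suc n) k = cong (k +_) (sum-const n k)

  term≤sum : ∀ {n} (f : Fin n → ℕ) i → f i ≤ sum f
  term≤sum f zero    = m≤m+n _ _
  term≤sum f (suc i) = ≤-trans (term≤sum (f ∘ suc) i) (m≤n+m _ _)

  sum-single : ∀ {n} (x : Fin n) → ∑[ z < n ] ⟦ does (z Fin.≟ x) ⟧ ≡ 1
  sum-single {suc n} zero    = cong suc (sum-zero {n} λ _ → refl)
  sum-single {suc n} (suc x) = sum-single x

  sum-cong : ∀ {n} {f g : Fin n → ℕ} → (∀ i → f i ≡ g i) → sum f ≡ sum g
  sum-cong = S.sum-cong-≗

  sum-remove : ∀ {n} (f : Fin (suc n) → ℕ) v → sum f ≡ f v + ∑[ i < n ] f (punchIn v i)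
  sum-remove f v = S.sum-remove {i = v} f

  sum-permute : ∀ {m n} (f : Fin n → ℕ) (π : Fin m ↔ Fin n) → sum f ≡ ∑[ i < m ] f (Inverse.to π i)
  sum-permute = S.sum-permute

  ∑-distrib-+ : ∀ {n} (f g : Fin n → ℕ) → ∑[ i < n ] (f i + g i) ≡ sum f + sum g
  ∑-distrib-+ = S.∑-distrib-+

  ∑-comm : ∀ {m n} (f : Fin m → Fin n → ℕ) →
           ∑[ i < m ] ∑[ j < n ] f i j ≡ ∑[ j < n ] ∑[ i < m ] f i j
  ∑-comm = S.∑-comm

  foldr-tabulate : ∀ {n} (f : Fin n → ℕ) → foldr _+_ 0 (List.tabulate f) ≡ sum f
  foldr-tabulate {zero}  f = refl
  foldr-tabulate {suc n} f = cong (f zero +_) (foldr-tabulate (f ∘ suc))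

  length-filter-tabulate : ∀ {a p n} {A : Set a} {P : Pred A p} (P? : Decidable P) (f : Fin n → A) →
    length (filter P? (List.tabulate f)) ≡ ∑[ i < n ] ⟦ does (P? (f i)) ⟧
  length-filter-tabulate {n = zero}  P? f = refl
  length-filter-tabulate {n = suc n} P? f with does (P? (f zero))
  ... | true  = cong suc (length-filter-tabulate P? (f ∘ suc))
  ... | false = length-filter-tabulate P? (f ∘ suc)

  ∣p∩q∣≡∑ : ∀ {n} (p q : Subset n) → ∣ p ∩ q ∣ ≡ ∑[ i < n ] ⟦ lookup p i ∧ lookup q i ⟧
  ∣p∩q∣≡∑ []          []          = refl
  ∣p∩q∣≡∑ (true  ∷ p) (true  ∷ q) = cong suc (∣p∩q∣≡∑ p q)
  ∣p∩q∣≡∑ (true  ∷ p) (false ∷ q) = ∣p∩q∣≡∑ p q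
  ∣p∩q∣≡∑ (false ∷ p) (_     ∷ q) = ∣p∩q∣≡∑ p q

  ∣p─q∣≡∑ : ∀ {n} (p q : Subset n) → ∣ p ─ q ∣ ≡ ∑[ i < n ] ⟦ lookup p i ∧ not (lookup q i) ⟧
  ∣p─q∣≡∑ []          []          = refl
  ∣p─q∣≡∑ (true  ∷ p) (true  ∷ q) = ∣p─q∣≡∑ p q
  ∣p─q∣≡∑ (true  ∷ p) (false ∷ q) = cong suc (∣p─q∣≡∑ p q)
  ∣p─q∣≡∑ (false ∷ p) (true  ∷ q) = ∣p─q∣≡∑ p q
  ∣p─q∣≡∑ (false ∷ p) (false ∷ q) = ∣p─q∣≡∑ p q

  *-distribˡ-sum : ∀ {n} k (f : Fin n → ℕ) → k * sum f ≡ ∑[ i < n ] (k * f i)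
  *-distribˡ-sum = S.*-distribˡ-sum

  *-distribʳ-sum : ∀ {n} k (f : Fin n → ℕ) → sum f * k ≡ ∑[ i < n ] (f i * k)
  *-distribʳ-sum = S.*-distribʳ-sum

length-filter-cartesianProduct : ∀ {a b p m n} {A : Set a} {B : Set b} {P : Pred (A × B) p}
  (P? : Decidable P) (f : Fin m → A) (g : Fin n → B) →
  length (filter P? (cartesianProduct (List.tabulate f) (List.tabulate g))) ≡
  ∑[ x < m ] ∑[ y < n ] ⟦ does (P? (f x , g y)) ⟧
length-filter-cartesianProduct {m = zero}  P? f g = sym (sum-zero λ ())
length-filter-cartesianProduct {m = suc m} {n} P? f g = begin
  length (filter P? (row ++ rest))
    ≡⟨ cong length (filter-++ P? row rest) ⟩
  length (filter P? row ++ filter P? rest)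
    ≡⟨ length-++ (filter P? row) ⟩
  length (filter P? row) + length (filter P? rest)
    ≡⟨ cong₂ _+_ (trans (cong (length ∘ filter P?) (map-tabulate g (f zero ,_)))
                        (length-filter-tabulate P? (λ y → f zero , g y)))
                 (length-filter-cartesianProduct P? (f ∘ suc) g) ⟩
  _ ≡⟨ sum-remove (λ x → ∑[ y < n ] ⟦ does (P? (f x , g y)) ⟧) zero ⟨
  ∑[ x < suc m ] ∑[ y < n ] ⟦ does (P? (f x , g y)) ⟧ ∎
  where
  open ≡-Reasoning
  row  = List.map (f zero ,_) (List.tabulate g)
  rest = cartesianProduct (List.tabulate (f ∘ suc)) (List.tabulate g)

∑-distrib₄ : ∀ {n} (f g h k : Fin n → ℕ) →
             ∑[ i < n ] (f i + g i + h i + k i) ≡ sum f + sum g + sum h + sum k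
∑-distrib₄ f g h k = trans (∑-distrib-+ _ k) (cong (_+ sum k)
  (trans (∑-distrib-+ _ h) (cong (_+ sum h) (∑-distrib-+ f g))))

∑∑-cong : ∀ {m n} {f g : Fin m → Fin n → ℕ} → (∀ x y → f x y ≡ g x y) →
          ∑[ x < m ] ∑[ y < n ] f x y ≡ ∑[ x < m ] ∑[ y < n ] g x y
∑∑-cong eq = sum-cong λ x → sum-cong (eq x)

∑∑-mono-≤ : ∀ {m n} {f g : Fin m → Fin n → ℕ} → (∀ x y → f x y ≤ g x y) →
            ∑[ x < m ] ∑[ y < n ] f x y ≤ ∑[ x < m ] ∑[ y < n ] g x y
∑∑-mono-≤ le = sum-mono-≤ λ x → sum-mono-≤ (le x)

∑∑-distrib-+ : ∀ {m n} (f g : Fin m → Fin n → ℕ) →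
               ∑[ x < m ] ∑[ y < n ] (f x y + g x y) ≡
               ∑[ x < m ] ∑[ y < n ] f x y + ∑[ x < m ] ∑[ y < n ] g x y
∑∑-distrib-+ f g = trans (sum-cong λ x → ∑-distrib-+ (f x) (g x)) (∑-distrib-+ _ _)

-- Row `v` is split off whole, so it contains the diagonal entry; the rest of column `v` is then
-- taken out of the other rows.
∑∑-remove : ∀ {n} (f : Fin (suc n) → Fin (suc n) → ℕ) v →
            ∑[ x < suc n ] ∑[ y < suc n ] f x y ≡
            (sum (f v) + ∑[ x < n ] f (punchIn v x) v) +
            ∑[ x < n ] ∑[ y < n ] f (punchIn v x) (punchIn v y)
∑∑-remove f v = begin
  ∑[ x < _ ] sum (f x)
    ≡⟨ sum-remove (λ x → sum (f x)) v ⟩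
  sum (f v) + ∑[ x < _ ] sum (f (punchIn v x))
    ≡⟨ cong (sum (f v) +_) (sum-cong λ x → sum-remove (f (punchIn v x)) v) ⟩
  sum (f v) + ∑[ x < _ ] (f (punchIn v x) v + ∑[ y < _ ] f (punchIn v x) (punchIn v y))
    ≡⟨ cong (sum (f v) +_) (∑-distrib-+ _ _) ⟩
  sum (f v) + (∑[ x < _ ] f (punchIn v x) v + ∑[ x < _ ] ∑[ y < _ ] f (punchIn v x) (punchIn v y))
    ≡⟨ +-assoc (sum (f v)) _ _ ⟨
  _ ∎
  where open ≡-Reasoning

-- Vertex classes of a pair, and pair sums

-- Adjacency in the complement. Requiring `x` and `y` to be distinct keeps both ends of a pair out
-- of `neither`, which therefore consists of the vertices that the pair fails to dominate.
nonadj : ∀ {n} → Graph n → Fin n → Fin n → Bool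
nonadj G x y = not (adj G x y) ∧ not (does (x Fin.≟ y))

both only neither : ∀ {n} → Graph n → Fin n → Fin n → Fin n → Bool
both    G x y z = adj G x z ∧ adj G y z
only    G x y z = adj G x z ∧ not (adj G y z)
neither G x y z = nonadj G x z ∧ nonadj G y z

#both #only #neither : ∀ {n} → Graph n → Fin n → Fin n → ℕ
#both    {n} G x y = ∑[ z < n ] ⟦ both G x y z ⟧
#only    {n} G x y = ∑[ z < n ] ⟦ only G x y z ⟧
#neither {n} G x y = ∑[ z < n ] ⟦ neither G x y z ⟧

Weight : Set
Weight = ℕ → ℕ → ℕ → ℕ → ℕ

weigh : ∀ {n} → Graph n → Weight → Fin n → Fin n → ℕ
weigh G w x y = w (#both G x y) (#only G x y) (#only G y x) (#neither G x y)

-- Ordered pairs are summed, since a weight may treat the two `only` classes differently; every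
-- unordered pair enters once in each orientation.
pairSum : ∀ {n} → Graph n → Weight → ℕ
pairSum {n} G w = ∑[ x < n ] ∑[ y < n ] (⟦ nonadj G x y ⟧ * weigh G w x y)

does-injective : ∀ {m n} (f : Fin m → Fin n) → (∀ {x y} → f x ≡ f y → x ≡ y) →
                 ∀ x y → does (f x Fin.≟ f y) ≡ does (x Fin.≟ y)
does-injective f inj x y with x Fin.≟ y
... | yes refl = dec-true  (f x Fin.≟ f x) refl
... | no  x≢y  = dec-false (f x Fin.≟ f y) (x≢y ∘ inj)

nonadj-card : ∀ {n} (G : Graph (suc n)) v x y →
              nonadj (card G v) x y ≡ nonadj G (punchIn v x) (punchIn v y)
nonadj-card G v x y = cong (λ b → not (adj G (punchIn v x) (punchIn v y)) ∧ not b)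
  (sym (does-injective (punchIn v) (punchIn-injective v _ _) x y))

neither-card : ∀ {n} (G : Graph (suc n)) v x y z →
               neither (card G v) x y z ≡ neither G (punchIn v x) (punchIn v y) (punchIn v z)
neither-card G v x y z = cong₂ _∧_ (nonadj-card G v x z) (nonadj-card G v y z)

#both-card : ∀ {n} (G : Graph (suc n)) v x y →
             #both G (punchIn v x) (punchIn v y) ≡
             ⟦ both G (punchIn v x) (punchIn v y) v ⟧ + #both (card G v) x y
#both-card G v x y = sum-remove _ v

#only-card : ∀ {n} (G : Graph (suc n)) v x y →
             #only G (punchIn v x) (punchIn v y) ≡
             ⟦ only G (punchIn v x) (punchIn v y) v ⟧ + #only (card G v) x y
#only-card G v x y = sum-remove _ v

#neither-card : ∀ {n} (G : Graph (suc n)) v x y →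
                #neither G (punchIn v x) (punchIn v y) ≡
                ⟦ neither G (punchIn v x) (punchIn v y) v ⟧ + #neither (card G v) x y
#neither-card G v x y = trans (sum-remove _ v)
  (cong (⟦ neither G (punchIn v x) (punchIn v y) v ⟧ +_)
    (sum-cong λ z → cong ⟦_⟧ (sym (neither-card G v x y z))))

weigh-cong : ∀ (w : Weight) {a a′ b b′ c c′ r r′} → a ≡ a′ → b ≡ b′ → c ≡ c′ → r ≡ r′ →
             w a b c r ≡ w a′ b′ c′ r′
weigh-cong w refl refl refl refl = refl

pairSum-≅ : ∀ {m n} {G : Graph m} {H : Graph n} → G ≅ H → ∀ w → pairSum G w ≡ pairSum H w
pairSum-≅ {G = G} {H} (π , π-adj) w = sym (begin
  pairSum H w
    ≡⟨ sum-permute _ π ⟩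
  ∑[ x < _ ] ∑[ y < _ ] (⟦ nonadj H (f x) y ⟧ * weigh H w (f x) y)
    ≡⟨ sum-cong (λ x → sum-permute _ π) ⟩
  ∑[ x < _ ] ∑[ y < _ ] (⟦ nonadj H (f x) (f y) ⟧ * weigh H w (f x) (f y))
    ≡⟨ ∑∑-cong (λ x y → cong₂ (λ b k → ⟦ b ⟧ * k) (nonadj≡ x y)
         (weigh-cong w (both≡ x y) (only≡ x y) (only≡ y x) (neither≡ x y))) ⟩
  pairSum G w ∎)
  where
  open ≡-Reasoning
  f = Inverse.to π

  nonadj≡ : ∀ x y → nonadj H (f x) (f y) ≡ nonadj G x y
  nonadj≡ x y = cong₂ (λ a b → not a ∧ not b) (sym (π-adj x y))
    (does-injective f (Injection.injective (↔⇒↣ π)) x y)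

  both≡ : ∀ x y → #both H (f x) (f y) ≡ #both G x y
  both≡ x y = trans (sum-permute _ π) (sum-cong λ z →
    cong₂ (λ a b → ⟦ a ∧ b ⟧) (sym (π-adj x z)) (sym (π-adj y z)))

  only≡ : ∀ x y → #only H (f x) (f y) ≡ #only G x y
  only≡ x y = trans (sum-permute _ π) (sum-cong λ z →
    cong₂ (λ a b → ⟦ a ∧ not b ⟧) (sym (π-adj x z)) (sym (π-adj y z)))

  neither≡ : ∀ x y → #neither H (f x) (f y) ≡ #neither G x y
  neither≡ x y = trans (sum-permute _ π) (sum-cong λ z →
    cong₂ (λ a b → ⟦ a ∧ b ⟧) (nonadj≡ x z) (nonadj≡ y z))

-- Summing over all vertex deletions

-- The factors count the ways to choose the deleted vertex within each class. The truncated
-- subtraction is harmless: where a size is 0, so is its factor.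
∂ : Weight → Weight
∂ w a b c r = a * w (a ∸ 1) b c r + b * w a (b ∸ 1) c r + c * w a b (c ∸ 1) r + r * w a b c (r ∸ 1)

does-sym : ∀ {n} (x y : Fin n) → does (x Fin.≟ y) ≡ does (y Fin.≟ x)
does-sym x y with x Fin.≟ y
... | yes refl = sym (dec-true (x Fin.≟ x) refl)
... | no  x≢y  = sym (dec-false (y Fin.≟ x) (x≢y ∘ sym))

nonadj-sym : ∀ {n} (G : Graph n) x y → nonadj G x y ≡ nonadj G y x
nonadj-sym G x y = cong₂ (λ a b → not a ∧ not b) (adj-sym G x y) (does-sym x y)

nonadj-irrefl : ∀ {n} (G : Graph n) x → nonadj G x x ≡ false
nonadj-irrefl G x rewrite adj-irrefl G x | dec-true (x Fin.≟ x) refl = refl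

nonadj⇒¬adj : ∀ {n} (G : Graph n) {x y} → nonadj G x y ≡ true → adj G x y ≡ false
nonadj⇒¬adj G {x} {y} nxy with adj G x y
... | false = refl

nonadj⇒≢ : ∀ {n} (G : Graph n) {x y} → nonadj G x y ≡ true → x ≢ y
nonadj⇒≢ G {x} nxy refl = contradiction (trans (sym nxy) (nonadj-irrefl G x)) λ ()

module _ {n} (G : Graph n) where

  -- The weight of (x , y) in G - z, and 0 when z is x or y.
  deleted : Weight → Fin n → Fin n → Fin n → ℕ
  deleted w z x y = ⟦ not (does (z Fin.≟ x)) ⟧ * (⟦ not (does (z Fin.≟ y)) ⟧ * (⟦ nonadj G x y ⟧ *
    w (#both G x y ∸ ⟦ both G x y z ⟧) (#only G x y ∸ ⟦ only G x y z ⟧)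
      (#only G y x ∸ ⟦ only G y x z ⟧) (#neither G x y ∸ ⟦ neither G x y z ⟧)))

  partition-pointwise : ∀ {x y} → nonadj G x y ≡ true → ∀ z →
    ⟦ both G x y z ⟧ + ⟦ only G x y z ⟧ + ⟦ only G y x z ⟧ + ⟦ neither G x y z ⟧ +
    (⟦ does (z Fin.≟ x) ⟧ + ⟦ does (z Fin.≟ y) ⟧) ≡ 1
  partition-pointwise {x} {y} nxy z
    rewrite does-sym x z | does-sym y z
    with z Fin.≟ x | z Fin.≟ y
  ... | yes refl | yes refl = contradiction refl (nonadj⇒≢ G nxy)
  ... | yes refl | no _ rewrite adj-irrefl G x | adj-sym G y x | nonadj⇒¬adj G nxy = refl
  ... | no _ | yes refl rewrite adj-irrefl G y | nonadj⇒¬adj G nxy = refl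
  ... | no _ | no _ with adj G x z | adj G y z
  ... | true  | true  = refl
  ... | true  | false = refl
  ... | false | true  = refl
  ... | false | false = refl

  -- The final 2 stands for `x` and `y`, which lie in none of the four classes, while any other
  -- vertex lies in exactly one.
  partition : ∀ {x y} → nonadj G x y ≡ true →
    #both G x y + #only G x y + #only G y x + #neither G x y + 2 ≡ n
  partition {x} {y} nxy = begin
    B + X + Y + R + 2
      ≡⟨ cong₂ (λ i j → B + X + Y + R + (i + j)) (sum-single x) (sum-single y) ⟨
    B + X + Y + R + (∑[ z < n ] ⟦ does (z Fin.≟ x) ⟧ + ∑[ z < n ] ⟦ does (z Fin.≟ y) ⟧)
      ≡⟨ cong (B + X + Y + R +_) (∑-distrib-+ _ _) ⟨
    B + X + Y + R + ∑[ z < n ] (⟦ does (z Fin.≟ x) ⟧ + ⟦ does (z Fin.≟ y) ⟧)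
      ≡⟨ cong (_+ _) (∑-distrib₄ _ _ _ _) ⟨
    _ ≡⟨ ∑-distrib-+ _ _ ⟨
    _ ≡⟨ sum-cong (partition-pointwise nxy) ⟩
    ∑[ z < n ] 1 ≡⟨ trans (sum-const n 1) (*-identityʳ n) ⟩
    n ∎
    where
    open ≡-Reasoning
    B = #both G x y
    X = #only G x y
    Y = #only G y x
    R = #neither G x y

  -- For `z` outside the pair exactly one of the four indicators is 1, and it selects the class size
  -- that drops; for `z` in the pair both sides are 0.
  deleted-pointwise : ∀ w {x y} → nonadj G x y ≡ true → ∀ z →
    let B = #both G x y; X = #only G x y; Y = #only G y x; R = #neither G x y in
    deleted w z x y ≡
    ⟦ both G x y z ⟧ * w (B ∸ 1) X Y R + ⟦ only G x y z ⟧ * w B (X ∸ 1) Y R +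
    ⟦ only G y x z ⟧ * w B X (Y ∸ 1) R + ⟦ neither G x y z ⟧ * w B X Y (R ∸ 1)
  deleted-pointwise w {x} {y} nxy z
    rewrite does-sym x z | does-sym y z | nxy
    with z Fin.≟ x | z Fin.≟ y
  ... | yes refl | yes refl = contradiction refl (nonadj⇒≢ G nxy)
  ... | yes refl | no _ rewrite adj-irrefl G x | adj-sym G y x | nonadj⇒¬adj G nxy = refl
  ... | no _ | yes refl rewrite adj-irrefl G y | nonadj⇒¬adj G nxy = refl
  ... | no _ | no _ with adj G x z | adj G y z
  ... | true  | true  = unit₁ _
    where
    unit₁ : ∀ k → 1 * (1 * (1 * k)) ≡ 1 * k + 0 + 0 + 0
    unit₁ = solve-∀
  ... | true  | false = unit₂ _
    where
    unit₂ : ∀ k → 1 * (1 * (1 * k)) ≡ 1 * k + 0 + 0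
    unit₂ = solve-∀
  ... | false | true  = unit₃ _
    where
    unit₃ : ∀ k → 1 * (1 * (1 * k)) ≡ 1 * k + 0
    unit₃ = solve-∀
  ... | false | false = unit₄ _
    where
    unit₄ : ∀ k → 1 * (1 * (1 * k)) ≡ 1 * k
    unit₄ = solve-∀

  sum-deleted : ∀ w x y → ∑[ z < n ] deleted w z x y ≡ ⟦ nonadj G x y ⟧ * weigh G (∂ w) x y
  sum-deleted w x y = by-cases (nonadj G x y) refl
    where
    open ≡-Reasoning

    vanish : ∀ a b → a * (b * 0) ≡ 0
    vanish = solve-∀

    by-cases : ∀ b → nonadj G x y ≡ b →
               ∑[ z < n ] deleted w z x y ≡ ⟦ nonadj G x y ⟧ * weigh G (∂ w) x y
    by-cases false nxy rewrite nxy =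
      sum-zero λ z → vanish ⟦ not (does (z Fin.≟ x)) ⟧ ⟦ not (does (z Fin.≟ y)) ⟧
    by-cases true nxy = begin
      ∑[ z < n ] deleted w z x y
        ≡⟨ sum-cong (deleted-pointwise w nxy) ⟩
      _ ≡⟨ ∑-distrib₄ _ _ _ _ ⟩
      -- The weights no longer depend on `z`, so the indicators sum up to the coefficients of `∂ w`.
      _ ≡⟨ cong₂ _+_ (cong₂ _+_ (cong₂ _+_ (*-distribʳ-sum _ (λ z → ⟦ both G x y z ⟧))
                                           (*-distribʳ-sum _ (λ z → ⟦ only G x y z ⟧)))
                                (*-distribʳ-sum _ (λ z → ⟦ only G y x z ⟧)))
                     (*-distribʳ-sum _ (λ z → ⟦ neither G x y z ⟧)) ⟨
      weigh G (∂ w) x y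
        ≡⟨ *-identityˡ _ ⟨
      1 * weigh G (∂ w) x y
        ≡⟨ cong (λ b → ⟦ b ⟧ * weigh G (∂ w) x y) nxy ⟨
      ⟦ nonadj G x y ⟧ * weigh G (∂ w) x y ∎

-- The guards in `deleted` annul row and column `v`. For the other pairs, each class size in `G` is
-- the one in the card plus the indicator at `v`, so the subtraction is exact.
pairSum-card : ∀ {n} (G : Graph (suc n)) v w →
               pairSum (card G v) w ≡ ∑[ x < suc n ] ∑[ y < suc n ] deleted G w v x y
pairSum-card {n} G v w = sym (begin
  ∑[ x < suc n ] ∑[ y < suc n ] deleted G w v x y
    ≡⟨ ∑∑-remove (deleted G w v) v ⟩
  (∑[ y < suc n ] deleted G w v v y + ∑[ x < n ] deleted G w v (punchIn v x) v) +
  ∑[ x < n ] ∑[ y < n ] deleted G w v (punchIn v x) (punchIn v y)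
    ≡⟨ cong (_+ ∑[ x < n ] ∑[ y < n ] deleted G w v (punchIn v x) (punchIn v y))
         (cong₂ _+_ (sum-zero λ y → at-v v) (sum-zero λ x → trans
         (cong (⟦ not (does (v Fin.≟ punchIn v x)) ⟧ *_) (at-v v))
         (*-zeroʳ ⟦ not (does (v Fin.≟ punchIn v x)) ⟧))) ⟩
  ∑[ x < n ] ∑[ y < n ] deleted G w v (punchIn v x) (punchIn v y)
    ≡⟨ ∑∑-cong off-v ⟩
  pairSum (card G v) w ∎)
  where
  open ≡-Reasoning

  at-v : ∀ v {k} → ⟦ not (does (v Fin.≟ v)) ⟧ * k ≡ 0
  at-v v rewrite dec-true (v Fin.≟ v) refl = refl

  drop : ∀ b {s t} → s ≡ ⟦ b ⟧ + t → s ∸ ⟦ b ⟧ ≡ t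
  drop b refl = m+n∸m≡n ⟦ b ⟧ _

  off-v : ∀ x y → deleted G w v (punchIn v x) (punchIn v y) ≡
                  ⟦ nonadj (card G v) x y ⟧ * weigh (card G v) w x y
  off-v x y
    rewrite dec-false (v Fin.≟ punchIn v x) (punchInᵢ≢i v x ∘ sym)
          | dec-false (v Fin.≟ punchIn v y) (punchInᵢ≢i v y ∘ sym)
    = trans (trans (*-identityˡ _) (*-identityˡ _)) (cong₂ (λ b k → ⟦ b ⟧ * k)
        (sym (nonadj-card G v x y))
        (weigh-cong w (drop (both G _ _ v) (#both-card G v x y))
                      (drop (only G _ _ v) (#only-card G v x y))
                      (drop (only G _ _ v) (#only-card G v y x))
                      (drop (neither G _ _ v) (#neither-card G v x y))))

-- Double counting as in Kelly's lemma: after the summations are exchanged, each pair is fixed and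
-- the deleted vertex varies.
kelly : ∀ {n} (G : Graph n) w → ∑[ v < n ] pairSum (card G v) w ≡ pairSum G (∂ w)
kelly {zero}  G w = trans (sum-zero λ ()) (sym (sum-zero λ ()))
kelly {suc n} G w = begin
  ∑[ v < suc n ] pairSum (card G v) w
    ≡⟨ sum-cong (λ v → pairSum-card G v w) ⟩
  ∑[ v < suc n ] ∑[ x < suc n ] ∑[ y < suc n ] deleted G w v x y
    ≡⟨ ∑-comm _ ⟩
  ∑[ x < suc n ] ∑[ v < suc n ] ∑[ y < suc n ] deleted G w v x y
    ≡⟨ sum-cong (λ x → ∑-comm _) ⟩
  ∑[ x < suc n ] ∑[ y < suc n ] ∑[ v < suc n ] deleted G w v x y
    ≡⟨ ∑∑-cong (sum-deleted G w) ⟩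
  pairSum G (∂ w) ∎
  where open ≡-Reasoning

-- Information carried by the deck

deck-sum : ∀ {n} (G : Graph n) (φ : ∃ Graph → ℕ) →
           foldr _+_ 0 (List.map φ (deck G)) ≡ ∑[ v < n ] φ (_ , card G v)
deck-sum {n} G φ = begin
  foldr _+_ 0 (List.map φ (List.map (λ v → _ , card G v) (allFin n)))
    ≡⟨ cong (foldr _+_ 0 ∘ List.map φ) (map-tabulate (λ v → v) (λ v → _ , card G v)) ⟩
  foldr _+_ 0 (List.map φ (List.tabulate (λ v → _ , card G v)))
    ≡⟨ cong (foldr _+_ 0) (map-tabulate (λ v → _ , card G v) φ) ⟩
  foldr _+_ 0 (List.tabulate (λ v → φ (_ , card G v)))
    ≡⟨ foldr-tabulate _ ⟩
  ∑[ v < n ] φ (_ , card G v) ∎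
  where open ≡-Reasoning

-- By `kelly` each side is a sum over the deck of an isomorphism invariant, and such a sum survives
-- permutation up to isomorphism.
pairSum-deck : ∀ {m n} {H : Graph m} {G : Graph n} → deck H ≈ᴰ deck G → ∀ w →
               pairSum H (∂ w) ≡ pairSum G (∂ w)
pairSum-deck {m} {n} {H} {G} D w = begin
  pairSum H (∂ w)                      ≡⟨ kelly H w ⟨
  ∑[ v < m ] pairSum (card H v) w      ≡⟨ deck-sum H φ ⟨
  foldr _+_ 0 (List.map φ (deck H))
    ≡⟨ ↭.foldr-commMonoid (setoid ℕ) +-0-isCommutativeMonoid
         (↭.map⁺ unlabelledGraphs (setoid ℕ)
           (λ {K} {L} K≅L → pairSum-≅ {G = proj₂ K} {H = proj₂ L} K≅L w) D) ⟩
  foldr _+_ 0 (List.map φ (deck G))    ≡⟨ deck-sum G φ ⟩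
  ∑[ v < n ] pairSum (card G v) w      ≡⟨ kelly G w ⟩
  pairSum G (∂ w) ∎
  where
  open ≡-Reasoning
  φ : ∃ Graph → ℕ
  φ (_ , K) = pairSum K w

length-deck : ∀ {n} (G : Graph n) → length (deck G) ≡ n
length-deck {n} G = trans (length-map _ (allFin n)) (length-tabulate {n = n} (λ v → v))

deck-order : ∀ {m n} (H : Graph m) (G : Graph n) → deck H ≈ᴰ deck G → m ≡ n
deck-order H G D = trans (sym (length-deck H))
  (trans (↭.xs↭ys⇒|xs|≡|ys| unlabelledGraphs D) (length-deck G))

deck-card : ∀ {m n} (H : Graph m) (G : Graph n) → deck H ≈ᴰ deck G →
            ∀ v → ∃ λ u → card G v ≅ card H u
deck-card H G D v = Any.tabulate⁻ (Any.map⁻ (↭.∈-resp-↭ unlabelledGraphs {x = _ , card G v}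
  (↭-sym unlabelledGraphs D)
  (Any.map⁺ (Any.tabulate⁺ v (≅-refl {G = card G v})))))

-- Calculus of weights

-- By `partition`, the only class sizes that occur are those with total `n - 2`; elsewhere the
-- weights are free to differ.
pairSum-cong : ∀ {n} (G : Graph n) {w w′ : Weight} →
  (∀ a b c r → a + b + c + r + 2 ≡ n → w a b c r ≡ w′ a b c r) → pairSum G w ≡ pairSum G w′
pairSum-cong {n} G {w} {w′} eq = ∑∑-cong pointwise
  where
  pointwise : ∀ x y → ⟦ nonadj G x y ⟧ * weigh G w x y ≡ ⟦ nonadj G x y ⟧ * weigh G w′ x y
  pointwise x y with nonadj G x y in nxy
  ... | false = refl
  ... | true  = cong (1 *_) (eq _ _ _ _ (partition G nxy))

pairSum-mono-≤ : ∀ {n} (G : Graph n) {w w′ : Weight} →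
  (∀ a b c r → w a b c r ≤ w′ a b c r) → pairSum G w ≤ pairSum G w′
pairSum-mono-≤ G le = ∑∑-mono-≤ λ x y → *-monoʳ-≤ ⟦ nonadj G x y ⟧ (le _ _ _ _)

pairSum-+ : ∀ {n} (G : Graph n) (w w′ : Weight) →
  pairSum G (λ a b c r → w a b c r + w′ a b c r) ≡ pairSum G w + pairSum G w′
pairSum-+ G w w′ = trans
  (∑∑-cong λ x y → *-distribˡ-+ ⟦ nonadj G x y ⟧ (weigh G w x y) (weigh G w′ x y))
  (∑∑-distrib-+ (λ x y → ⟦ nonadj G x y ⟧ * weigh G w x y) (λ x y → ⟦ nonadj G x y ⟧ * weigh G w′ x y))

pairSum-* : ∀ {n} (G : Graph n) k (w : Weight) →
  pairSum G (λ a b c r → k * w a b c r) ≡ k * pairSum G w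
pairSum-* G k w = sym (trans (*-distribˡ-sum k _) (sum-cong λ x →
  trans (*-distribˡ-sum k _) (sum-cong λ y → swap k ⟦ nonadj G x y ⟧ (weigh G w x y))))
  where
  swap : ∀ i j l → i * (j * l) ≡ j * (i * l)
  swap = solve-∀

one : Weight
one _ _ _ _ = 1

pairSum≤square : ∀ {n} (G : Graph n) {w : Weight} → (∀ a b c r → w a b c r ≤ 1) → pairSum G w ≤ n * n
pairSum≤square {n} G {w} w≤1 = begin
  pairSum G w              ≤⟨ ∑∑-mono-≤ (λ x y → *-mono-≤ (⟦⟧≤1 (nonadj G x y)) (w≤1 _ _ _ _)) ⟩
  ∑[ x < n ] ∑[ y < n ] 1  ≡⟨ sum-cong (λ x → trans (sum-const n 1) (*-identityʳ n)) ⟩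
  ∑[ x < n ] n             ≡⟨ sum-const n n ⟩
  n * n                    ∎
  where
  open ≤-Reasoning
  ⟦⟧≤1 : ∀ b → ⟦ b ⟧ ≤ 1
  ⟦⟧≤1 true  = s≤s z≤n
  ⟦⟧≤1 false = z≤n

-- Indicator weights

δ : ℕ → ℕ → ℕ
δ i j = ⟦ does (i ≟ j) ⟧

δ-refl : ∀ i → δ i i ≡ 1
δ-refl i rewrite dec-true (i ≟ i) refl = refl

δ-≢ : ∀ {i j} → i ≢ j → δ i j ≡ 0
δ-≢ {i} {j} i≢j rewrite dec-false (i ≟ j) i≢j = refl

δ≤1 : ∀ i j → δ i j ≤ 1
δ≤1 i j with does (i ≟ j)
... | true  = s≤s z≤n
... | false = z≤n

-- Both sides are `suc i` if `j ≡ suc i` and 0 otherwise. A lowered argument thus becomes a raised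
-- index, which makes `∂` of an indicator a combination of indicators.
δ-shift : ∀ i j → j * δ i (j ∸ 1) ≡ suc i * δ (suc i) j
δ-shift i zero    = sym (*-zeroʳ (suc i))
δ-shift i (suc j) with i ≟ j
... | yes refl rewrite δ-refl i = refl
... | no  i≢j  rewrite δ-≢ i≢j | *-zeroʳ i | *-zeroʳ j = refl

point : ℕ → ℕ → ℕ → ℕ → Weight
point a b c r a′ b′ c′ r′ = δ a a′ * δ b b′ * δ c c′ * δ r r′

-- Each summand of `∂` lowers a single argument, so `δ-shift` applies to one factor and the other
-- three are carried along.
∂-point : ∀ a b c r a′ b′ c′ r′ → ∂ (point a b c r) a′ b′ c′ r′ ≡
  suc a * point (suc a) b c r a′ b′ c′ r′ + suc b * point a (suc b) c r a′ b′ c′ r′ +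
  suc c * point a b (suc c) r a′ b′ c′ r′ + suc r * point a b c (suc r) a′ b′ c′ r′
∂-point a b c r a′ b′ c′ r′ = cong₂ _+_ (cong₂ _+_ (cong₂ _+_
  (through₁ a′ (suc a) (δ b b′) (δ c c′) (δ r r′) (δ-shift a a′))
  (through₂ b′ (suc b) (δ a a′) (δ c c′) (δ r r′) (δ-shift b b′)))
  (through₃ c′ (suc c) (δ a a′) (δ b b′) (δ r r′) (δ-shift c c′)))
  (through₄ r′ (suc r) (δ a a′) (δ b b′) (δ c c′) (δ-shift r r′))
  where
  assoc₁ : ∀ k d x y z → k * (d * x * y * z) ≡ (k * d) * (x * y * z)
  assoc₁ = solve-∀
  assoc₂ : ∀ k d x y z → k * (x * d * y * z) ≡ (k * d) * (x * y * z)
  assoc₂ = solve-∀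
  assoc₃ : ∀ k d x y z → k * (x * y * d * z) ≡ (k * d) * (x * y * z)
  assoc₃ = solve-∀
  assoc₄ : ∀ k d x y z → k * (x * y * z * d) ≡ (k * d) * (x * y * z)
  assoc₄ = solve-∀

  through₁ : ∀ k l {d e} x y z → k * d ≡ l * e → k * (d * x * y * z) ≡ l * (e * x * y * z)
  through₁ k l {d} {e} x y z eq =
    trans (assoc₁ k d x y z) (trans (cong (_* (x * y * z)) eq) (sym (assoc₁ l e x y z)))
  through₂ : ∀ k l {d e} x y z → k * d ≡ l * e → k * (x * d * y * z) ≡ l * (x * e * y * z)
  through₂ k l {d} {e} x y z eq =
    trans (assoc₂ k d x y z) (trans (cong (_* (x * y * z)) eq) (sym (assoc₂ l e x y z)))
  through₃ : ∀ k l {d e} x y z → k * d ≡ l * e → k * (x * y * d * z) ≡ l * (x * y * e * z)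
  through₃ k l {d} {e} x y z eq =
    trans (assoc₃ k d x y z) (trans (cong (_* (x * y * z)) eq) (sym (assoc₃ l e x y z)))
  through₄ : ∀ k l {d e} x y z → k * d ≡ l * e → k * (x * y * z * d) ≡ l * (x * y * z * e)
  through₄ k l {d} {e} x y z eq =
    trans (assoc₄ k d x y z) (trans (cong (_* (x * y * z)) eq) (sym (assoc₄ l e x y z)))

-- From pair sums to `dv`

∣N∩N∣≡#both : ∀ {n} (G : Graph n) x y → ∣ N G x ∩ N G y ∣ ≡ #both G x y
∣N∩N∣≡#both G x y = trans (∣p∩q∣≡∑ (N G x) (N G y)) (sum-cong λ z →
  cong₂ (λ a b → ⟦ a ∧ b ⟧) (lookup∘tabulate (adj G x) z) (lookup∘tabulate (adj G y) z))

∣N─N∣≡#only : ∀ {n} (G : Graph n) x y → ∣ N G x ─ N G y ∣ ≡ #only G x y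
∣N─N∣≡#only G x y = trans (∣p─q∣≡∑ (N G x) (N G y)) (sum-cong λ z →
  cong₂ (λ a b → ⟦ a ∧ not b ⟧) (lookup∘tabulate (adj G x) z) (lookup∘tabulate (adj G y) z))

point-refl : ∀ a b c r → point a b c r a b c r ≡ 1
point-refl a b c r rewrite δ-refl a | δ-refl b | δ-refl c | δ-refl r = refl

point-≢ : ∀ {a b c a′ b′ c′} r r′ → ¬ (a ≡ a′ × b ≡ b′ × c ≡ c′) → point a b c r a′ b′ c′ r′ ≡ 0
point-≢ {a} {b} {c} {a′} {b′} {c′} r r′ ≢ with a ≟ a′ | b ≟ b′ | c ≟ c′
... | no ≢a | _     | _     rewrite δ-≢ ≢a = refl
... | yes _ | no ≢b | _     rewrite δ-≢ ≢b | *-zeroʳ (δ a a′) = refl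
... | yes _ | yes _ | no ≢c rewrite δ-≢ ≢c | *-zeroʳ (δ a a′ * δ b b′) = refl
... | yes p | yes q | yes s = contradiction (p , q , s) ≢

-- A profile prescribes three class sizes only; `partition` and the given total force the fourth to
-- be `r`.
weigh-point : ∀ {n} (G : Graph n) {a b c r} → a + b + c + r + 2 ≡ n → ∀ {x y} → nonadj G x y ≡ true →
              weigh G (point a b c r) x y ≡ ⟦ does (profile? G a b c x y) ⟧
weigh-point G {a} {b} {c} {r} total {x} {y} nxy with profile? G a b c x y
... | yes (profile p q s) = trans (weigh-cong (point a b c r) A≡a X≡b Y≡c R≡r) (point-refl a b c r)
  where
  A≡a = trans (sym (∣N∩N∣≡#both G x y)) p
  X≡b = trans (sym (∣N─N∣≡#only G x y)) q
  Y≡c = trans (sym (∣N─N∣≡#only G y x)) s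
  R≡r : #neither G x y ≡ r
  R≡r = +-cancelˡ-≡ (a + b + c) _ _ (+-cancelʳ-≡ 2 _ _ (trans
    (cong (λ k → k + #neither G x y + 2) (sym (cong₂ _+_ (cong₂ _+_ A≡a X≡b) Y≡c)))
    (trans (partition G nxy) (sym total))))
... | no ¬π = point-≢ r _ λ (p , q , s) → ¬π (profile
  (trans (∣N∩N∣≡#both G x y) (sym p))
  (trans (∣N─N∣≡#only G x y) (sym q))
  (trans (∣N─N∣≡#only G y x) (sym s)))

dv≡∑ : ∀ {n} (G : Graph n) a b c → dv G a b c ≡ ∑[ x < n ] ∑[ y < n ] ⟦ does (dvPair? G a b c (x , y)) ⟧
dv≡∑ {n} G a b c = length-filter-cartesianProduct (dvPair? G a b c) (λ x → x) (λ y → y)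

-- An unordered pair is counted by dv once, but by the ordered sum once for each
-- labelling realising (a, b, c): twice when b ≡ c, once otherwise.
dv-pairSum : ∀ {n} (G : Graph n) {a b c r} → a + b + c + r + 2 ≡ n →
             suc (δ b c) * dv G a b c ≡ pairSum G (point a b c r)
dv-pairSum {n} G {a} {b} {c} {r} total = sym (begin
  pairSum G (point a b c r)
    ≡⟨ ∑∑-cong split ⟩
  ∑[ x < n ] ∑[ y < n ] (up x y * p x y + up y x * p x y)
    ≡⟨ ∑∑-distrib-+ (λ x y → up x y * p x y) (λ x y → up y x * p x y) ⟩
  ∑[ x < n ] ∑[ y < n ] (up x y * p x y) + ∑[ x < n ] ∑[ y < n ] (up y x * p x y)
    -- Exchanging `x` and `y` turns each descending pair into an ascending one with the roles in the
    -- profile swapped.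
    ≡⟨ cong (∑[ x < n ] ∑[ y < n ] (up x y * p x y) +_) (∑-comm (λ x y → up y x * p x y)) ⟩
  ∑[ x < n ] ∑[ y < n ] (up x y * p x y) + ∑[ x < n ] ∑[ y < n ] (up x y * p y x)
    ≡⟨ ∑∑-distrib-+ (λ x y → up x y * p x y) (λ x y → up x y * p y x) ⟨
  ∑[ x < n ] ∑[ y < n ] (up x y * p x y + up x y * p y x)
    ≡⟨ ∑∑-cong merge ⟩
  ∑[ x < n ] ∑[ y < n ] (suc (δ b c) * ⟦ does (dvPair? G a b c (x , y)) ⟧)
    ≡⟨ sum-cong (λ x → *-distribˡ-sum (suc (δ b c)) _) ⟨
  ∑[ x < n ] (suc (δ b c) * ∑[ y < n ] ⟦ does (dvPair? G a b c (x , y)) ⟧)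
    ≡⟨ *-distribˡ-sum (suc (δ b c)) _ ⟨
  suc (δ b c) * ∑[ x < n ] ∑[ y < n ] ⟦ does (dvPair? G a b c (x , y)) ⟧
    ≡⟨ cong (suc (δ b c) *_) (dv≡∑ G a b c) ⟨
  suc (δ b c) * dv G a b c ∎)
  where
  open ≡-Reasoning

  up p : Fin n → Fin n → ℕ
  up x y = ⟦ does (x <ᶠ? y) ∧ not (adj G x y) ⟧
  p  x y = ⟦ does (profile? G a b c x y) ⟧

  -- A non-adjacent pair of distinct vertices is ascending in exactly one of its two orders; the
  -- diagonal contributes 0 to both sides.
  orient : ∀ x y → ⟦ nonadj G x y ⟧ ≡ up x y + up y x
  orient x y rewrite adj-sym G y x with Fin.<-cmp x y
  ... | tri< lt ≢ ≯ rewrite dec-true (x <ᶠ? y) lt | dec-false (x Fin.≟ y) ≢ | dec-false (y <ᶠ? x) ≯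
                with adj G x y
  ...   | true  = refl
  ...   | false = refl
  orient x y | tri> ≮ ≢ gt rewrite dec-false (x <ᶠ? y) ≮ | dec-false (x Fin.≟ y) ≢ | dec-true (y <ᶠ? x) gt
                with adj G x y
  ...   | true  = refl
  ...   | false = refl
  orient x y | tri≈ ≮ eq ≯ rewrite dec-false (x <ᶠ? y) ≮ | dec-true (x Fin.≟ y) eq | dec-false (y <ᶠ? x) ≯
                with adj G x y
  ...   | true  = refl
  ...   | false = refl

  split : ∀ x y → ⟦ nonadj G x y ⟧ * weigh G (point a b c r) x y ≡ up x y * p x y + up y x * p x y
  split x y = trans (by-profile (nonadj G x y) refl)
    (trans (cong (_* p x y) (orient x y)) (*-distribʳ-+ (p x y) (up x y) (up y x)))
    where
    by-profile : ∀ k → nonadj G x y ≡ k →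
                 ⟦ nonadj G x y ⟧ * weigh G (point a b c r) x y ≡ ⟦ nonadj G x y ⟧ * p x y
    by-profile true  nxy = cong (⟦ nonadj G x y ⟧ *_) (weigh-point G total nxy)
    by-profile false nxy rewrite nxy = refl

  -- With `b ≡ c` a profile is symmetric in the two vertices, so a pair with a single valid
  -- labelling has `b ≢ c`.
  asymmetric : ∀ x y → Profile G a b c x y → ¬ Profile G a b c y x → b ≢ c
  asymmetric x y (profile i j k) ¬π refl =
    ¬π (profile (trans (cong ∣_∣ (∩-comm (N G y) (N G x))) i) k j)

  labellings : ∀ x y → p x y + p y x ≡
    suc (δ b c) * ⟦ does (profile? G a b c x y) ∨ does (profile? G a b c y x) ⟧
  labellings x y with profile? G a b c x y | profile? G a b c y x
  -- Two valid labellings force `b ≡ c`, and then both sides equal 2.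
  ... | yes (profile _ q s) | yes (profile _ q′ s′) rewrite trans (sym q) s′ | δ-refl c = refl
  ... | yes π | no ¬π rewrite δ-≢ (asymmetric x y π ¬π) = refl
  ... | no ¬π | yes π rewrite δ-≢ (asymmetric y x π ¬π) = refl
  ... | no _ | no _ = sym (*-zeroʳ (suc (δ b c)))

  merge : ∀ x y → up x y * p x y + up x y * p y x ≡ suc (δ b c) * ⟦ does (dvPair? G a b c (x , y)) ⟧
  merge x y = trans (sym (*-distribˡ-+ (up x y) (p x y) (p y x)))
    (trans (cong (up x y *_) (labellings x y)) (gather (does (x <ᶠ? y)) (adj G x y)))
    where
    gather : ∀ k l {m} → ⟦ k ∧ not l ⟧ * (suc (δ b c) * ⟦ m ⟧) ≡
             suc (δ b c) * ⟦ k ∧ not (does (l ≟ᵇ true)) ∧ m ⟧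
    gather true  true  = sym (*-zeroʳ (suc (δ b c)))
    gather true  false = *-identityˡ _
    gather false _     = sym (*-zeroʳ (suc (δ b c)))

-- Universal vertices

-- A non-adjacent pair survives in exactly the `N` cards that keep both of its vertices, so `∂ one`
-- is the constant `N` on the class sizes that occur.
pairSum-one : ∀ {N} (G : Graph (N + 2)) → pairSum G (∂ one) ≡ N * pairSum G one
pairSum-one {N} G = trans
  (pairSum-cong G λ a b c r eq → trans (units a b c r) (cong (_* 1) (+-cancelʳ-≡ 2 _ N eq)))
  (pairSum-* G N one)
  where
  units : ∀ a b c r → a * 1 + b * 1 + c * 1 + r * 1 ≡ (a + b + c + r) * 1
  units = solve-∀

-- Expressed by `nonadj`, which is false on the diagonal, the condition makes no exception for `v`
-- itself.
Universal : ∀ {n} → Graph n → Fin n → Set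
Universal G v = ∀ x → nonadj G v x ≡ false

nonadj-false : ∀ {n} (G : Graph n) {x y} → nonadj G x y ≡ false → x ≡ y ⊎ Adj G x y
nonadj-false G {x} {y} nxy with adj G x y | x Fin.≟ y
... | true  | _       = inj₂ refl
... | false | yes x≡y = inj₁ x≡y

-- No non-adjacent pair contains `v`, and `v` is a common neighbour of each such pair, so its
-- deletion lowers the first class size by one and changes no other.
universal-pairSum : ∀ {n} (G : Graph (suc n)) {v} → Universal G v → ∀ w →
                    pairSum G w ≡ pairSum (card G v) (λ a → w (suc a))
universal-pairSum {n} G {v} univ w = begin
  pairSum G w
    ≡⟨ ∑∑-remove (λ x y → ⟦ nonadj G x y ⟧ * weigh G w x y) v ⟩
  (∑[ y < suc n ] (⟦ nonadj G v y ⟧ * weigh G w v y) +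
   ∑[ x < n ] (⟦ nonadj G (punchIn v x) v ⟧ * weigh G w (punchIn v x) v)) +
  rest
    ≡⟨ cong (_+ rest) (cong₂ _+_
         (sum-zero λ y → cong (λ b → ⟦ b ⟧ * weigh G w v y) (univ y))
         (sum-zero λ x → cong (λ b → ⟦ b ⟧ * weigh G w (punchIn v x) v) (univ′ x))) ⟩
  rest
    ≡⟨ ∑∑-cong (λ x y → cong₂ (λ b k → ⟦ b ⟧ * k) (sym (nonadj-card G v x y))
         (weigh-cong w (both≡ x y) (only≡ x y) (only≡ y x) (neither≡ x y))) ⟩
  pairSum (card G v) (λ a → w (suc a)) ∎
  where
  open ≡-Reasoning
  rest = ∑[ x < n ] ∑[ y < n ]
    (⟦ nonadj G (punchIn v x) (punchIn v y) ⟧ * weigh G w (punchIn v x) (punchIn v y))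

  univ′ : ∀ x → nonadj G (punchIn v x) v ≡ false
  univ′ x = trans (nonadj-sym G _ v) (univ _)

  adj-v : ∀ x → adj G (punchIn v x) v ≡ true
  adj-v x with nonadj-false G (univ′ x)
  ... | inj₁ eq = contradiction eq (punchInᵢ≢i v x)
  ... | inj₂ vx = vx

  both≡ : ∀ x y → #both G (punchIn v x) (punchIn v y) ≡ suc (#both (card G v) x y)
  both≡ x y = trans (#both-card G v x y)
    (cong₂ (λ k l → ⟦ k ∧ l ⟧ + #both (card G v) x y) (adj-v x) (adj-v y))

  only≡ : ∀ x y → #only G (punchIn v x) (punchIn v y) ≡ #only (card G v) x y
  only≡ x y = trans (#only-card G v x y)
    (cong₂ (λ k l → ⟦ k ∧ not l ⟧ + #only (card G v) x y) (adj-v x) (adj-v y))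

  neither≡ : ∀ x y → #neither G (punchIn v x) (punchIn v y) ≡ #neither (card G v) x y
  neither≡ x y = trans (#neither-card G v x y)
    (cong (λ k → ⟦ k ∧ nonadj G (punchIn v y) v ⟧ + #neither (card G v) x y) (univ′ x))

-- The card loses exactly the non-adjacent pairs that contain `v`; if the counts agree, there are
-- none.
universal-count : ∀ {n} (G : Graph (suc n)) v → pairSum G one ≡ pairSum (card G v) one → Universal G v
universal-count {n} G v eq x = zero-indicator (nonadj G v x) (n≤0⇒n≡0 (begin
  ⟦ nonadj G v x ⟧                        ≡⟨ *-identityʳ _ ⟨
  ⟦ nonadj G v x ⟧ * 1                    ≤⟨ term≤sum (λ y → ⟦ nonadj G v y ⟧ * 1) x ⟩
  ∑[ y < suc n ] (⟦ nonadj G v y ⟧ * 1)   ≤⟨ m≤m+n _ _ ⟩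
  incident                                ≡⟨ +-cancelʳ-≡ (pairSum (card G v) one) incident 0 no-incident ⟩
  0                                       ∎))
  where
  open ≤-Reasoning
  incident = ∑[ y < suc n ] (⟦ nonadj G v y ⟧ * 1) + ∑[ x < n ] (⟦ nonadj G (punchIn v x) v ⟧ * 1)

  no-incident : incident + pairSum (card G v) one ≡ pairSum (card G v) one
  no-incident = trans (cong (incident +_) (∑∑-cong λ x y → cong (λ b → ⟦ b ⟧ * 1) (nonadj-card G v x y)))
    (trans (sym (∑∑-remove (λ x y → ⟦ nonadj G x y ⟧ * 1) v)) eq)

  zero-indicator : ∀ b → ⟦ b ⟧ ≡ 0 → b ≡ false
  zero-indicator false _ = refl

-- A card obtained by deleting a universal vertex of G can only arise from H by
-- deleting a universal vertex, because the number of non-adjacent pairs is reconstructible.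
universal-reconstruct : ∀ {N} {H G : Graph (suc N + 2)} → deck H ≈ᴰ deck G →
  ∀ {v} → Universal G v → ∀ w → pairSum H w ≡ pairSum G w
universal-reconstruct {N} {H} {G} D {v} univ w with deck-card H G D v
... | u , card≅ = begin
  pairSum H w                            ≡⟨ universal-pairSum H univ-u w ⟩
  pairSum (card H u) (λ a → w (suc a))   ≡⟨ pairSum-≅ {G = card G v} {H = card H u} card≅ (λ a → w (suc a)) ⟨
  pairSum (card G v) (λ a → w (suc a))   ≡⟨ universal-pairSum G univ w ⟨
  pairSum G w                            ∎
  where
  open ≡-Reasoning

  -- `∂ one` multiplies the number of pairs by `suc N`, which is positive and can be cancelled.
  same-count : pairSum H one ≡ pairSum G one
  same-count = *-cancelˡ-≡ _ _ (suc N)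
    (trans (sym (pairSum-one H)) (trans (pairSum-deck {H = H} {G = G} D one) (pairSum-one G)))

  univ-u : Universal H u
  univ-u = universal-count H u (begin
    pairSum H one           ≡⟨ same-count ⟩
    pairSum G one           ≡⟨ universal-pairSum G univ one ⟩
    pairSum (card G v) one  ≡⟨ pairSum-≅ {G = card G v} {H = card H u} card≅ one ⟩
    pairSum (card H u) one  ∎)

-- Pairs missing a given number of vertices

undominated : ℕ → Weight
undominated i _ _ _ r = δ i r

-- The first three summands of `∂` leave `r` alone and together carry the factor `a + b + c`, which
-- is `N ∸ i` when `r` is `i`; the fourth is handled by `δ-shift`.
pairSum-undominated : ∀ {N} (G : Graph (N + 2)) i → pairSum G (∂ (undominated i)) ≡
  (N ∸ i) * pairSum G (undominated i) + suc i * pairSum G (undominated (suc i))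
pairSum-undominated {N} G i = begin
  pairSum G (∂ (undominated i))
    ≡⟨ pairSum-cong G pointwise ⟩
  pairSum G (λ a b c r → (N ∸ i) * δ i r + suc i * δ (suc i) r)
    ≡⟨ pairSum-+ G (λ a b c r → (N ∸ i) * δ i r) (λ a b c r → suc i * δ (suc i) r) ⟩
  pairSum G (λ a b c r → (N ∸ i) * δ i r) + pairSum G (λ a b c r → suc i * δ (suc i) r)
    ≡⟨ cong₂ _+_ (pairSum-* G (N ∸ i) (undominated i)) (pairSum-* G (suc i) (undominated (suc i))) ⟩
  _ ∎
  where
  open ≡-Reasoning

  collect : ∀ a b c d → a * d + b * d + c * d ≡ (a + b + c) * d
  collect = solve-∀

  dominated : ∀ a b c r → a + b + c + r + 2 ≡ N + 2 → (a + b + c) * δ i r ≡ (N ∸ i) * δ i r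
  dominated a b c r eq with i ≟ r
  ... | yes refl = cong (_* δ i i) (trans (sym (m+n∸n≡m (a + b + c) i))
                     (cong (_∸ i) (+-cancelʳ-≡ 2 (a + b + c + i) N eq)))
  ... | no  i≢r  rewrite δ-≢ i≢r = trans (*-zeroʳ (a + b + c)) (sym (*-zeroʳ (N ∸ i)))

  pointwise : ∀ a b c r → a + b + c + r + 2 ≡ N + 2 →
              ∂ (undominated i) a b c r ≡ (N ∸ i) * δ i r + suc i * δ (suc i) r
  pointwise a b c r eq = cong₂ _+_ (trans (collect a b c (δ i r)) (dominated a b c r eq)) (δ-shift i r)

-- One step of the recursion for the differences of pairSum (undominated i):
-- if m (p − q) = x and k (p − q) = l (q′ − p′) then m l (q′ − p′) = k x.
alternate : ∀ x p q p′ q′ k l m → x + m * q ≡ m * p → k * p + l * p′ ≡ k * q + l * q′ →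
            k * x + (m * l) * p′ ≡ (m * l) * q′
alternate x p q p′ q′ k l m diff step = +-cancelˡ-≡ (k * (m * q)) _ _ (begin
  k * (m * q) + (k * x + (m * l) * p′)   ≡⟨ regroup k l m x q p′ ⟩
  k * (x + m * q) + m * (l * p′)         ≡⟨ cong (λ e → k * e + m * (l * p′)) diff ⟩
  k * (m * p) + m * (l * p′)             ≡⟨ factor k l m p p′ ⟩
  m * (k * p + l * p′)                   ≡⟨ cong (m *_) step ⟩
  m * (k * q + l * q′)                   ≡⟨ expand k l m q q′ ⟩
  k * (m * q) + (m * l) * q′             ∎)
  where
  open ≡-Reasoning
  regroup : ∀ k l m x q p′ → k * (m * q) + (k * x + (m * l) * p′) ≡ k * (x + m * q) + m * (l * p′)
  regroup = solve-∀
  factor : ∀ k l m p p′ → k * (m * p) + m * (l * p′) ≡ m * (k * p + l * p′)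
  factor = solve-∀
  expand : ∀ k l m q q′ → m * (k * q + l * q′) ≡ k * (m * q) + (m * l) * q′
  expand = solve-∀

-- With N for `10 + p`, this says that N choose 4 exceeds the square of the order N + 2, the factor
-- 24 being 4 factorial. It is here that the lower bound on the order enters.
square<quartic : ∀ p → 24 * ((10 + p + 2) * (10 + p + 2)) < (7 + p) * ((8 + p) * ((9 + p) * (10 + p)))
-- Right side minus left side minus 1 is a polynomial in `p` with nonnegative coefficients,
-- displayed in `expand`.
square<quartic p = ≤-trans (s≤s (m≤m+n (24 * ((10 + p + 2) * (10 + p + 2))) _)) (≤-reflexive (sym (expand p)))
  where
  expand : ∀ p → (7 + p) * ((8 + p) * ((9 + p) * (10 + p))) ≡
    suc (24 * ((10 + p + 2) * (10 + p + 2)) +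
         (1583 + 1838 * p + 407 * (p * p) + 34 * (p * p * p) + p * p * p * p))
  expand = solve-∀

module _ {p} {H G : Graph (10 + p + 2)} (D : deck H ≈ᴰ deck G) where

  undominated-step : ∀ i →
    (10 + p ∸ i) * pairSum H (undominated i) + suc i * pairSum H (undominated (suc i)) ≡
    (10 + p ∸ i) * pairSum G (undominated i) + suc i * pairSum G (undominated (suc i))
  undominated-step i = trans (sym (pairSum-undominated H i))
    (trans (pairSum-deck {H = H} {G = G} D (undominated i)) (pairSum-undominated G i))

  -- By the recursion, the counts of `H` and `G` at index i differ by N choose i times the number of
  -- dominating pairs of `H`, where N is `10 + p` and the sign alternates with i. At the even index
  -- 4 the excess lies with `H`, whose count is at most the square of the order.
  dominating-pairs : pairSum G (undominated 0) ≡ 0 → pairSum H (undominated 0) ≡ 0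
  dominating-pairs g₀≡0 = vanishes (h 0) refl
    where
    open ≤-Reasoning
    g h : ℕ → ℕ
    g i = pairSum G (undominated i)
    h i = pairSum H (undominated i)

    -- The factorials 1, 1, 2, 6, 24 clear the denominators of the binomial coefficients. As the
    -- sign alternates, `g` and `h` change sides at every step and every second `undominated-step`
    -- is reversed.
    diff₀ : h 0 + 1 * g 0 ≡ 1 * h 0
    diff₀ = trans (cong (λ k → h 0 + 1 * k) g₀≡0) (trans (+-identityʳ (h 0)) (sym (*-identityˡ (h 0))))

    diff₁ : (10 + p) * h 0 + 1 * h 1 ≡ 1 * g 1
    diff₁ = alternate (h 0) (h 0) (g 0) (h 1) (g 1) (10 + p) 1 1 diff₀ (undominated-step 0)

    diff₂ : (9 + p) * ((10 + p) * h 0) + 2 * g 2 ≡ 2 * h 2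
    diff₂ = alternate ((10 + p) * h 0) (g 1) (h 1) (g 2) (h 2) (9 + p) 2 1 diff₁ (sym (undominated-step 1))

    diff₃ : (8 + p) * ((9 + p) * ((10 + p) * h 0)) + 6 * h 3 ≡ 6 * g 3
    diff₃ = alternate ((9 + p) * ((10 + p) * h 0)) (h 2) (g 2) (h 3) (g 3) (8 + p) 3 2 diff₂ (undominated-step 2)

    diff₄ : (7 + p) * ((8 + p) * ((9 + p) * ((10 + p) * h 0))) + 24 * g 4 ≡ 24 * h 4
    diff₄ = alternate ((8 + p) * ((9 + p) * ((10 + p) * h 0))) (g 3) (h 3) (g 4) (h 4) (7 + p) 4 6 diff₃ (sym (undominated-step 3))

    vanishes : ∀ t → t ≡ h 0 → h 0 ≡ 0
    vanishes zero    eq = sym eq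
    vanishes (suc t) eq = contradiction (begin-strict
      24 * ((10 + p + 2) * (10 + p + 2))
        <⟨ square<quartic p ⟩
      (7 + p) * ((8 + p) * ((9 + p) * (10 + p)))
        ≤⟨ *-monoʳ-≤ (7 + p) (*-monoʳ-≤ (8 + p) (*-monoʳ-≤ (9 + p)
             (subst (λ k → 10 + p ≤ (10 + p) * k) eq (m≤m*n (10 + p) (suc t))))) ⟩
      (7 + p) * ((8 + p) * ((9 + p) * ((10 + p) * h 0)))
        ≤⟨ m≤m+n _ (24 * g 4) ⟩
      (7 + p) * ((8 + p) * ((9 + p) * ((10 + p) * h 0))) + 24 * g 4
        ≡⟨ diff₄ ⟩
      24 * h 4
        ≤⟨ *-monoʳ-≤ 24 (pairSum≤square H {undominated 4} (λ _ _ _ r → δ≤1 4 r)) ⟩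
      24 * ((10 + p + 2) * (10 + p + 2)) ∎) (<-irrefl refl)

-- Recursion on the number of missed vertices

pairSum-∂-point : ∀ {n} (G : Graph n) a b c r → pairSum G (∂ (point a b c r)) ≡
  suc a * pairSum G (point (suc a) b c r) + suc b * pairSum G (point a (suc b) c r) +
  suc c * pairSum G (point a b (suc c) r) + suc r * pairSum G (point a b c (suc r))
pairSum-∂-point G a b c r = begin
  pairSum G (∂ (point a b c r))
    ≡⟨ pairSum-cong G (λ a′ b′ c′ r′ _ → ∂-point a b c r a′ b′ c′ r′) ⟩
  pairSum G (((suc a · wa ⊕ suc b · wb) ⊕ suc c · wc) ⊕ suc r · wr)
    ≡⟨ pairSum-+ G ((suc a · wa ⊕ suc b · wb) ⊕ suc c · wc) (suc r · wr) ⟩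
  _ ≡⟨ cong₂ _+_ (pairSum-+ G (suc a · wa ⊕ suc b · wb) (suc c · wc)) (pairSum-* G (suc r) wr) ⟩
  _ ≡⟨ cong (_+ suc r * pairSum G wr) (cong₂ _+_
         (trans (pairSum-+ G (suc a · wa) (suc b · wb))
                (cong₂ _+_ (pairSum-* G (suc a) wa) (pairSum-* G (suc b) wb)))
         (pairSum-* G (suc c) wc)) ⟩
  _ ∎
  where
  open ≡-Reasoning
  wa = point (suc a) b c r
  wb = point a (suc b) c r
  wc = point a b (suc c) r
  wr = point a b c (suc r)
  infixl 6 _⊕_
  infixl 7 _·_
  _⊕_ : Weight → Weight → Weight
  (w ⊕ w′) a b c r = w a b c r + w′ a b c r
  _·_ : ℕ → Weight → Weight
  (k · w) a b c r = k * w a b c r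

-- Induction on `r`: in `∂ (point a b c r)` a single term has level `suc r`, with a positive
-- coefficient, and the other three have level `r`. Those raise `a`, `b` or `c`, so the induction
-- runs over all triples at once.
points-agree : ∀ {n} {H G : Graph n} → deck H ≈ᴰ deck G →
  (∀ a b c → pairSum H (point a b c 0) ≡ pairSum G (point a b c 0)) →
  ∀ r a b c → pairSum H (point a b c r) ≡ pairSum G (point a b c r)
points-agree D base zero = base
points-agree {H = H} {G} D base (suc r) a b c = *-cancelˡ-≡ _ _ (suc r)
  (+-cancelˡ-≡ (known H) _ _ (begin
    known H + suc r * pairSum H (point a b c (suc r))  ≡⟨ pairSum-∂-point H a b c r ⟨
    pairSum H (∂ (point a b c r))                      ≡⟨ pairSum-deck {H = H} {G = G} D (point a b c r) ⟩
    pairSum G (∂ (point a b c r))                      ≡⟨ pairSum-∂-point G a b c r ⟩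
    known G + suc r * pairSum G (point a b c (suc r))  ≡⟨ cong (_+ suc r * pairSum G (point a b c (suc r))) same ⟨
    known H + suc r * pairSum G (point a b c (suc r))  ∎))
  where
  open ≡-Reasoning
  ih = points-agree {H = H} {G} D base r
  known : Graph _ → ℕ
  known K = suc a * pairSum K (point (suc a) b c r) + suc b * pairSum K (point a (suc b) c r) +
            suc c * pairSum K (point a b (suc c) r)
  same : known H ≡ known G
  same = cong₂ _+_ (cong₂ _+_ (cong (suc a *_) (ih (suc a) b c)) (cong (suc b *_) (ih a (suc b) c)))
                   (cong (suc c *_) (ih a b (suc c)))

point≤undominated : ∀ a b c a′ b′ c′ r′ → point a b c 0 a′ b′ c′ r′ ≤ undominated 0 a′ b′ c′ r′
point≤undominated a b c a′ b′ c′ r′ = ≤-trans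
  (*-monoˡ-≤ (δ 0 r′) (*-mono-≤ (*-mono-≤ (δ≤1 a a′) (δ≤1 b b′)) (δ≤1 c c′)))
  (≤-reflexive (*-identityˡ (δ 0 r′)))

-- Dominating pairs and the domination number

∣p∪q∣≤∣p∣+∣q∣ : ∀ {n} (p q : Subset n) → ∣ p ∪ q ∣ ≤ ∣ p ∣ + ∣ q ∣
∣p∪q∣≤∣p∣+∣q∣ []          []          = z≤n
∣p∪q∣≤∣p∣+∣q∣ (true  ∷ p) (true  ∷ q) =
  s≤s (≤-trans (∣p∪q∣≤∣p∣+∣q∣ p q) (+-monoʳ-≤ ∣ p ∣ (n≤1+n ∣ q ∣)))
∣p∪q∣≤∣p∣+∣q∣ (true  ∷ p) (false ∷ q) = s≤s (∣p∪q∣≤∣p∣+∣q∣ p q)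
∣p∪q∣≤∣p∣+∣q∣ (false ∷ p) (true  ∷ q) =
  ≤-trans (s≤s (∣p∪q∣≤∣p∣+∣q∣ p q)) (≤-reflexive (sym (+-suc ∣ p ∣ ∣ q ∣)))
∣p∪q∣≤∣p∣+∣q∣ (false ∷ p) (false ∷ q) = ∣p∪q∣≤∣p∣+∣q∣ p q

pair-dominating : ∀ {n} (G : Graph n) {x y} → #neither G x y ≡ 0 → Dominating G (⁅ x ⁆ ∪ ⁅ y ⁆)
pair-dominating G {x} {y} none z with nonadj G x z in nxz | nonadj G y z in nyz
... | false | _ with nonadj-false G nxz
...   | inj₁ refl = inj₁ (x∈p∪q⁺ (inj₁ (x∈⁅x⁆ x)))
...   | inj₂ xz   = inj₂ (x , x∈p∪q⁺ (inj₁ (x∈⁅x⁆ x)) , xz)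
pair-dominating G {x} {y} none z | true | false with nonadj-false G nyz
...   | inj₁ refl = inj₁ (x∈p∪q⁺ (inj₂ (x∈⁅x⁆ y)))
...   | inj₂ yz   = inj₂ (y , x∈p∪q⁺ (inj₂ (x∈⁅x⁆ y)) , yz)
pair-dominating G {x} {y} none z | true | true = contradiction
  (subst (_≤ #neither G x y) (cong₂ (λ k l → ⟦ k ∧ l ⟧) nxz nyz) (term≤sum (λ z → ⟦ neither G x y z ⟧) z))
  (λ le → contradiction (subst (1 ≤_) none le) λ ())

two-members : ∀ {n} {S : Subset n} {u v} → u ∈ S → v ∈ S → v ≢ u → 2 ≤ ∣ S ∣
two-members {S = S} {u} {v} u∈S v∈S v≢u = subst (λ k → suc k ≤ ∣ S ∣) (∣⁅x⁆∣≡1 u) (p⊂q⇒∣p∣<∣q∣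
  ((λ x∈⁅u⁆ → subst (_∈ S) (sym (x∈⁅y⁆⇒x≡y u x∈⁅u⁆)) u∈S) , v , v∈S , λ v∈⁅u⁆ → v≢u (x∈⁅y⁆⇒x≡y u v∈⁅u⁆)))

-- A member `u` of `S` fails to dominate some `x`, and whatever dominates `x` is a second member.
-- The vertex argument serves to find a first member.
dominating-size : ∀ {n} (G : Graph n) → (∀ v → ∃ λ x → nonadj G v x ≡ true) →
                  Fin n → ∀ {S} → Dominating G S → 2 ≤ ∣ S ∣
dominating-size G missed z {S} dom = two (member z)
  where
  member : ∀ z → ∃ λ u → u ∈ S
  member z with dom z
  ... | inj₁ z∈S           = z , z∈S
  ... | inj₂ (u , u∈S , _) = u , u∈S

  two : (∃ λ u → u ∈ S) → 2 ≤ ∣ S ∣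
  two (u , u∈S) with missed u
  ... | x , nux with dom x
  ...   | inj₁ x∈S             = two-members u∈S x∈S (nonadj⇒≢ G nux ∘ sym)
  ...   | inj₂ (v , v∈S , vx)  = two-members u∈S v∈S
            λ { refl → contradiction (trans (sym vx) (nonadj⇒¬adj G nux)) λ () }

-- The dominating pair gives the upper bound; the lower bound holds because a single vertex would
-- have to be universal.
γ-two : ∀ {n} (G : Graph n) → (∀ v → ∃ λ x → nonadj G v x ≡ true) →
        ∀ {x y} → #neither G x y ≡ 0 → γ G ≡ 2
γ-two G missed {x} {y} none = ≤-antisym
  (≤-trans (proj₂ minimum _ (pair-dominating G none)) (≤-trans (∣p∪q∣≤∣p∣+∣q∣ ⁅ x ⁆ ⁅ y ⁆)
    (≤-reflexive (cong₂ _+_ (∣⁅x⁆∣≡1 x) (∣⁅x⁆∣≡1 y)))))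
  (dominating-size G missed x (proj₁ minimum))
  where minimum = proj₂ (minimumDominatingSet G)

no-dominating-pair : ∀ {n} (G : Graph n) → (∀ v → ∃ λ x → nonadj G v x ≡ true) → γ G ≢ 2 →
                     pairSum G (undominated 0) ≡ 0
no-dominating-pair G missed γ≢2 = sum-zero λ x → sum-zero λ y →
  trans (cong (⟦ nonadj G x y ⟧ *_) (δ-≢ λ none → γ≢2 (γ-two G missed {x} {y} (sym none))))
        (*-zeroʳ ⟦ nonadj G x y ⟧)

-- Case distinction and conclusion

universal? : ∀ {n} (G : Graph n) → (∃ (Universal G)) ⊎ (∀ v → ∃ λ x → nonadj G v x ≡ true)
universal? {n} G with any? (λ v → all? (λ x → nonadj G v x ≟ᵇ false))
... | yes univ  = inj₁ univ
... | no  ¬univ = inj₂ λ v → missed v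
  where
  missed : ∀ v → ∃ λ x → nonadj G v x ≡ true
  missed v with ¬∀⟶∃¬ n _ (λ x → nonadj G v x ≟ᵇ false) (λ univ → ¬univ (v , univ))
  ... | x , ≢false = x , ¬-not ≢false

points-reconstruct : ∀ {p} {H G : Graph (10 + p + 2)} → γ G ≢ 2 → deck H ≈ᴰ deck G →
  ∀ a b c r → pairSum H (point a b c r) ≡ pairSum G (point a b c r)
points-reconstruct {p} {H} {G} γ≢2 D a b c r = [ universal , non-universal ]′ (universal? G)
  where
  universal : ∃ (Universal G) → pairSum H (point a b c r) ≡ pairSum G (point a b c r)
  universal (v , univ) = universal-reconstruct {N = 9 + p} {H} {G} D {v} univ (point a b c r)

  -- A point weight at level 0 is supported on dominating pairs, so without such pairs it sums to 0.
  top : ∀ (K : Graph (10 + p + 2)) → pairSum K (undominated 0) ≡ 0 → ∀ a b c → pairSum K (point a b c 0) ≡ 0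
  top K k₀≡0 a b c = n≤0⇒n≡0 (subst (pairSum K (point a b c 0) ≤_) k₀≡0
    (pairSum-mono-≤ K {point a b c 0} {undominated 0} (point≤undominated a b c)))

  non-universal : (∀ v → ∃ λ x → nonadj G v x ≡ true) → pairSum H (point a b c r) ≡ pairSum G (point a b c r)
  non-universal missed = points-agree {H = H} {G} D
    (λ a b c → trans (top H (dominating-pairs {H = H} {G} D g₀≡0) a b c) (sym (top G g₀≡0 a b c))) r a b c
    where
    g₀≡0 : pairSum G (undominated 0) ≡ 0
    g₀≡0 = no-dominating-pair G missed γ≢2

dv-reconstruct : ∀ {p} {H G : Graph (10 + p + 2)} → γ G ≢ 2 → deck H ≈ᴰ deck G →
  ∀ a b c → a + b + c ≤ 10 + p → dv H a b c ≡ dv G a b c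
dv-reconstruct {p} {H} {G} γ≢2 D a b c bound = *-cancelˡ-≡ _ _ (suc (δ b c)) (begin
  suc (δ b c) * dv H a b c     ≡⟨ dv-pairSum H {a} {b} {c} {r} total ⟩
  pairSum H (point a b c r)    ≡⟨ points-reconstruct {p} {H} {G} γ≢2 D a b c r ⟩
  pairSum G (point a b c r)    ≡⟨ dv-pairSum G {a} {b} {c} {r} total ⟨
  suc (δ b c) * dv G a b c     ∎)
  where
  open ≡-Reasoning
  -- The three prescribed class sizes leave only this value for the number of missed vertices.
  r = 10 + p ∸ (a + b + c)
  total : a + b + c + r + 2 ≡ 10 + p + 2
  total = cong (_+ 2) (m+[n∸m]≡n bound)

-- The orders are kept as variables so that matching on `refl` brings both graphs to the form
-- `10 + p + 2`.
dv-reconstruct-order : ∀ {m n} p → m ≡ n → n ≡ 10 + p + 2 → {H : Graph m} {G : Graph n} →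
  γ G ≢ 2 → deck H ≈ᴰ deck G → ∀ a b c → a + b + c ≤ n ∸ 2 → dv H a b c ≡ dv G a b c
dv-reconstruct-order p refl refl {H} {G} γ≢2 D a b c le =
  dv-reconstruct {p} {H} {G} γ≢2 D a b c (subst (a + b + c ≤_) (m+n∸n≡m (10 + p) 2) le)

theorem15 : ∀ (n : ℕ) (G : Graph n) → 12 ≤ n → Connected G → γ G ≢ 2 →
    ∀ (m : ℕ) (H : Graph m) → deck H ≈ᴰ deck G →
    (∀ (k₁ k₂ k₃ : ℕ) → k₁ + k₂ + k₃ ≤ n ∸ 3 → dv H k₁ k₂ k₃ ≡ dv G k₁ k₂ k₃) ×
    (∀ (k₁ k : ℕ) → k₁ + 2 * k ≤ n ∸ 3 → dv H k₁ k k ≡ dv G k₁ k k)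
theorem15 n G 12≤n _ γ≢2 m H D = all , λ k₁ k le → all k₁ k k (subst (_≤ n ∸ 3) (double k₁ k) le)
  where
  double : ∀ i k → i + 2 * k ≡ i + k + k
  double = solve-∀

  twelve : ∀ p → p + 12 ≡ 10 + p + 2
  twelve = solve-∀

  all : ∀ a b c → a + b + c ≤ n ∸ 3 → dv H a b c ≡ dv G a b c
  all a b c le = dv-reconstruct-order (n ∸ 12) (deck-order H G D)
    (trans (sym (m∸n+n≡m 12≤n)) (twelve (n ∸ 12))) {H} {G} γ≢2 D a b c
    -- `dv-reconstruct-order` reaches up to `n ∸ 2`, so the bound `n ∸ 3` is relaxed first.
    (≤-trans le (∸-monoʳ-≤ n (n≤1+n 2)))
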